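{- Let $G$ be any graph on $n$ vertices. For each edge $e\in E(G)$ let $c(e)$ denote the largest $r$ such that $e$ is an edge of a subgraph of $G$ isomorphic to $K_r$ (so $c(e)\ge 2$). Then \[ \sum_{e\in E(G)} \frac{c(e)}{c(e)-1} \le \frac{n^2}{2}, \] and equality holds if and only if $G$ is a complete multipartite graph with at least two parts, all parts having the same size.
   Context: $K_r$ denotes the complete graph on $r$ vertices. Graphs are finite and simple. -}

module Defs where

open import Data.Fin.Base using (Fin; zero; suc)
open import Data.Fin.Properties using (_≟_; _<?_; any?; all?; injective⇒≤)
open import Data.Integer.Base using (+_)
open import Data.Nat.Base as ℕ using (ℕ; zero; suc; _∸_; _≤_; z≤n; s≤s)
open import Data.Nat.Properties as ℕ using (m≤n⇒m<n∨m≡n)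
open import Data.Product.Base using (∃; Σ-syntax; _×_; _,_; proj₁; proj₂)
open import Data.Rational.Base using (ℚ; 0ℚ; _/_)
open import Data.Rational.Properties using (+-0-commutativeMonoid)
open import Data.Sum.Base using (inj₁; inj₂)
open import Data.Vec.Base using (Vec; []; _∷_; lookup; tabulate; allFin; count)
open import Data.Vec.Properties using (lookup∘tabulate)
open import Function.Base using (id; _∘_)
open import Function.Bundles using (_⇔_; mk⇔; Equivalence)
open import Function.Definitions using (Injective)
open import Level using (0ℓ; Level)
open import Relation.Binary.Core using (Rel)
import Relation.Binary.Definitions as B
open import Relation.Binary.PropositionalEquality
  using (_≡_; _≢_; refl; sym; subst; subst₂)
open import Relation.Nullary.Decidable
  using (Dec; yes; no; ¬?; map′; _×-dec_; _→-dec_)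
open import Relation.Nullary.Negation using (¬_; contradiction)
open import Relation.Unary using (Pred; Decidable)

open import Algebra.Properties.CommutativeMonoid.Sum +-0-commutativeMonoid
  using (sum-syntax)

private variable
  n r : ℕ
  p : Level

record Graph (n : ℕ) : Set₁ where
  field
    Adj     : Rel (Fin n) 0ℓ
    adj?    : B.Decidable Adj
    adj-sym : B.Symmetric Adj
    irrefl  : ∀ {v} → ¬ Adj v v

open Graph public

K : ∀ r → Graph r
K r .Adj         = _≢_
K r .adj? i j    = ¬? (i ≟ j)
K r .adj-sym i≢j = i≢j ∘ sym
K r .irrefl v≢v  = v≢v refl

record Subgraph (G : Graph n) : Set₁ where
  field
    Vertex   : Pred (Fin n) 0ℓ
    Edge     : Rel (Fin n) 0ℓ
    edge-sym : B.Symmetric Edge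
    edge⇒adj : ∀ {u v} → Edge u v → Adj G u v
    edge⇒vtx : ∀ {u v} → Edge u v → Vertex u × Vertex v

open Subgraph public

record _≅_ {G : Graph n} (H : Subgraph G) (F : Graph r) : Set where
  field
    from      : Fin r → Fin n
    injective : Injective _≡_ _≡_ from
    image     : ∀ v → Vertex H v ⇔ ∃ λ i → from i ≡ v
    edges     : ∀ i j → Adj F i j ⇔ Edge H (from i) (from j)

EdgeOfK : Graph n → (u v : Fin n) → ℕ → Set₁
EdgeOfK G u v r = Σ[ H ∈ Subgraph G ] (H ≅ K r × Edge H u v)

-- Auxiliary: a finitely searchable form of EdgeOfK, equivalent to it by
-- clique⇒edgeOfK and edgeOfK⇒clique below.
CliqueThrough : Graph n → (u v : Fin n) → Vec (Fin n) r → Set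
CliqueThrough G u v xs =
  (∀ i j → i ≢ j → Adj G (lookup xs i) (lookup xs j)) ×
  (∃ λ i → ∃ λ j → i ≢ j × lookup xs i ≡ u × lookup xs j ≡ v)

private
  anyVec? : ∀ r {P : Pred (Vec (Fin n) r) p} → Decidable P → Dec (∃ P)
  anyVec? zero    P? = map′ (λ q → [] , q) (λ { ([] , q) → q }) (P? [])
  anyVec? (suc r) P? = map′
    (λ (x , xs , q) → x ∷ xs , q)
    (λ { (x ∷ xs , q) → x , xs , q })
    (any? λ x → anyVec? r λ xs → P? (x ∷ xs))

cliqueThrough? : (G : Graph n) (u v : Fin n) →
                 Decidable (CliqueThrough {r = r} G u v)
cliqueThrough? G u v xs =
  (all? λ i → all? λ j → ¬? (i ≟ j) →-dec adj? G (lookup xs i) (lookup xs j))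
  ×-dec
  (any? λ i → any? λ j →
     ¬? (i ≟ j) ×-dec (lookup xs i ≟ u) ×-dec (lookup xs j ≟ v))

clique⇒edgeOfK : (G : Graph n) {u v : Fin n} →
                 ∃ (CliqueThrough {r = r} G u v) → EdgeOfK G u v r
clique⇒edgeOfK {n} {r} G {u} {v} (xs , clq , i₀ , j₀ , i₀≢j₀ , pu , pv) =
  H , iso , (i₀ , j₀ , i₀≢j₀ , pu , pv)
  where
  f = lookup xs

  H : Subgraph G
  H .Vertex w = ∃ λ i → f i ≡ w
  H .Edge w x = ∃ λ i → ∃ λ j → i ≢ j × f i ≡ w × f j ≡ x
  H .edge-sym (i , j , i≢j , p , q) = j , i , i≢j ∘ sym , q , p
  H .edge⇒adj (i , j , i≢j , p , q) = subst₂ (Adj G) p q (clq i j i≢j)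
  H .edge⇒vtx (i , j , i≢j , p , q) = (i , p) , (j , q)

  iso : H ≅ K r
  iso = record
    { from      = f
    ; injective = inj
    ; image     = λ _ → mk⇔ id id
    ; edges     = λ i j → mk⇔
        (λ i≢j → i , j , i≢j , refl , refl)
        (λ e i≡j → irrefl G (subst (λ k → Adj G (f i) (f k)) (sym i≡j)
                                   (H .edge⇒adj e)))
    }
    where
    inj : Injective _≡_ _≡_ f
    inj {i} {j} eq with i ≟ j
    ... | yes i≡j = i≡j
    ... | no  i≢j =
      contradiction (subst (Adj G (f i)) (sym eq) (clq i j i≢j)) (irrefl G)

edgeOfK⇒clique : (G : Graph n) {u v : Fin n} →
                 EdgeOfK G u v r → ∃ (CliqueThrough {r = r} G u v)
edgeOfK⇒clique {r = r} G {u} {v} (H , iso , e) =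
  tabulate from , clq , ends
  where
  open _≅_ iso

  clq : ∀ i j → i ≢ j →
        Adj G (lookup (tabulate from) i) (lookup (tabulate from) j)
  clq i j i≢j
    rewrite lookup∘tabulate from i | lookup∘tabulate from j
    = H .edge⇒adj (Equivalence.to (edges i j) i≢j)

  ends : ∃ λ i → ∃ λ j → i ≢ j × lookup (tabulate from) i ≡ u
                               × lookup (tabulate from) j ≡ v
  ends with Equivalence.to (image u) (proj₁ (H .edge⇒vtx e))
          | Equivalence.to (image v) (proj₂ (H .edge⇒vtx e))
  ... | i , refl | j , refl =
    i , j , Equivalence.from (edges i j) e ,
    lookup∘tabulate from i , lookup∘tabulate from j

edgeOfK? : (G : Graph n) (u v : Fin n) → Decidable (EdgeOfK G u v)
edgeOfK? G u v r = map′ (clique⇒edgeOfK G) (edgeOfK⇒clique G)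
                        (anyVec? r (cliqueThrough? G u v))

edgeOfK⇒≤ : (G : Graph n) {u v : Fin n} → EdgeOfK G u v r → r ≤ n
edgeOfK⇒≤ G (_ , iso , _) = injective⇒≤ (_≅_.injective iso)

edgeOfK₂ : (G : Graph n) {u v : Fin n} → Adj G u v → EdgeOfK G u v 2
edgeOfK₂ G {u} {v} uv = clique⇒edgeOfK G
  ( u ∷ v ∷ []
  , (λ { zero       zero       i≢j → contradiction refl i≢j
       ; zero       (suc zero) i≢j → uv
       ; (suc zero) zero       i≢j → adj-sym G uv
       ; (suc zero) (suc zero) i≢j → contradiction refl i≢j })
  , zero , suc zero , (λ ()) , refl , refl )

IsLargest : Pred ℕ p → Pred ℕ p
IsLargest P m = P m × (∀ {k} → P k → k ≤ m)

largest : {P : Pred ℕ p} → Decidable P → ∀ b →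
          (∀ {k} → P k → k ≤ b) → ∃ P → ∃ (IsLargest P)
largest P? b bound (k , pk) with P? b
... | yes pb = b , pb , bound
largest {P = P} P? zero bound (k , pk) | no ¬pb with bound pk
... | z≤n = contradiction pk ¬pb
largest {P = P} P? (suc b) bound (k , pk) | no ¬pb =
  largest P? b bound′ (k , pk)
  where
  bound′ : ∀ {k} → P k → k ≤ b
  bound′ pk with m≤n⇒m<n∨m≡n (bound pk)
  ... | inj₁ (s≤s k≤b) = k≤b
  ... | inj₂ refl      = contradiction pk ¬pb

largestK : (G : Graph n) {u v : Fin n} → Adj G u v →
           ∃ (IsLargest (EdgeOfK G u v))
largestK {n} G {u} {v} uv =
  largest (edgeOfK? G u v) n (edgeOfK⇒≤ G) (2 , edgeOfK₂ G uv)

c : (G : Graph n) {u v : Fin n} → Adj G u v → ℕ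
c G uv = proj₁ (largestK G uv)

c-isLargest : (G : Graph n) {u v : Fin n} (uv : Adj G u v) →
              IsLargest (EdgeOfK G u v) (c G uv)
c-isLargest G uv = proj₂ (largestK G uv)

2≤c : (G : Graph n) {u v : Fin n} (uv : Adj G u v) → 2 ≤ c G uv
2≤c G uv = proj₂ (c-isLargest G uv) (edgeOfK₂ G uv)

c∸1-nonZero : (G : Graph n) {u v : Fin n} (uv : Adj G u v) →
              ℕ.NonZero (c G uv ∸ 1)
c∸1-nonZero G uv = ℕ.>-nonZero (ℕ.∸-monoˡ-≤ 1 (2≤c G uv))

-- Each edge {u , v} is counted once, through its orientation u < v.
edgeTerm : (G : Graph n) → (∀ {u v} → Adj G u v → ℚ) → Fin n → Fin n → ℚ
edgeTerm G w u v with u <? v | adj? G u v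
... | yes _ | yes uv = w uv
... | _     | _      = 0ℚ

edgeSum : (G : Graph n) → (∀ {u v} → Adj G u v → ℚ) → ℚ
edgeSum {n} G w = ∑[ u < n ] ∑[ v < n ] edgeTerm G w u v

weight : (G : Graph n) {u v : Fin n} → Adj G u v → ℚ
weight G uv = _/_ (+ c G uv) (c G uv ∸ 1) {{c∸1-nonZero G uv}}

IsCompleteMultipartite : Graph n → (Fin n → Fin r) → Set
IsCompleteMultipartite G part = ∀ u v → Adj G u v ⇔ part u ≢ part v

partSize : (Fin n → Fin r) → Fin r → ℕ
partSize {n} part i = count (λ v → part v ≟ i) (allFin n)

-- Parts are not required to be nonempty: equal sizes already force this
-- when n > 0, and for n = 0 the empty graph has r empty parts, matching the
-- fact that 0 = 0² / 2 is an equality.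
IsEqualCompleteMultipartite : Graph n → Set
IsEqualCompleteMultipartite {n} G =
  ∃ λ r → 2 ≤ r × Σ[ part ∈ (Fin n → Fin r) ]
    (IsCompleteMultipartite G part ×
     (∀ i j → partSize part i ≡ partSize part j))

{-# OPTIONS --safe #-}
module Submission where

-- Give every ordered pair of adjacent vertices its weight c / (c − 1), all other
-- pairs weight 0. The total weight over a list of m vertices is at most m²: peel
-- off a maximal clique K. A vertex v with d neighbours in K forms a clique with
-- them, so its edges into K weigh at most d · (d + 1) / d = d + 1, and d < |K| by
-- maximality (v itself is a non-neighbour when v ∈ K). Hence every row into K is
-- at most |K|, and induction handles the rest.
--
-- In case of equality d = |K| − 1 for all v and all maximal cliques K. If u and w
-- were adjacent and v adjacent to neither, a maximal clique through u w would
-- violate this, so non-adjacency is transitive and its classes are indexed by the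
-- vertices of any maximal clique. In a complete r-partite graph with nonempty
-- parts of sizes aᵢ every c is r, and the total is n² exactly when r Σ aᵢ² = n²,
-- that is, when Σ (r aᵢ − n)² = 0.

open import Defs
open import Algebra.Bundles using (CommutativeRing)
open import Data.Bool.Base using (true; false; if_then_else_)
open import Data.Fin.Base as Fin using (Fin; zero; suc)
import Data.Fin.Properties as Fin
open import Data.Integer.Base as ℤ using (+_)
import Data.Integer.Properties as ℤ
open import Data.List.Base as List
  using (List; []; _∷_; _++_; [_]; length; filter; tabulate)
open import Data.List.Membership.Propositional using (_∈_)
open import Data.List.Membership.Propositional.Properties
  using (∈-∃++; ∈-allFin; ∈-lookup)
import Data.List.Properties as List
open import Data.List.Relation.Binary.Permutation.Propositional as ↭
  using (_↭_; ↭-sym; ↭-trans; prep; swap)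
open import Data.List.Relation.Binary.Permutation.Propositional.Properties
  using (shift; ↭-length; All-resp-↭; Any-resp-↭)
open import Data.List.Relation.Unary.All as All using (All; []; _∷_; all?)
import Data.List.Relation.Unary.All.Properties as All
open import Data.List.Relation.Unary.AllPairs using (AllPairs; []; _∷_)
import Data.List.Relation.Unary.AllPairs.Properties as AllPairs
open import Data.List.Relation.Unary.Any as Any using (Any; here; there)
import Data.List.Relation.Unary.Any.Properties as Any
open import Data.Nat.Base as ℕ using (ℕ; zero; suc; _^_; _∸_; z≤n; s≤s)
import Data.Nat.Properties as ℕ
open import Data.Product.Base using (∃; ∃₂; Σ-syntax; _×_; _,_; proj₁; proj₂)
open import Data.Rational.Base
  using (ℚ; _≤_; _<_; _/_; _+_; _*_; -_; 0ℚ; 1ℚ; toℚᵘ;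
         Positive; nonNegative; positive; nonPositive; negative)
open import Data.Rational.Properties
open import Data.Rational.Solver using (module +-*-Solver)
import Data.Rational.Unnormalised.Base as ℚᵘ
import Data.Rational.Unnormalised.Properties as ℚᵘ
open import Data.Sum.Base using (inj₁; inj₂)
import Data.Vec.Base as Vec
import Data.Vec.Properties as Vec
open import Function.Base using (_∘_; id; flip)
open import Function.Bundles using (_⇔_; mk⇔; Equivalence)
open import Function.Construct.Composition using (_⇔-∘_)
open import Relation.Binary.Definitions using (Symmetric; tri<; tri≈; tri>)
open import Relation.Binary.PropositionalEquality hiding ([_])
open import Relation.Nullary.Decidable
  using (Dec; yes; no; does; dec-true; dec-false; decidable-stable)
open import Relation.Nullary.Negation using (¬_; contradiction)
open import Relation.Unary using (∁)

open import Algebra.Properties.AbelianGroup +-0-abelianGroup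
  using () renaming (∙-cancelˡ to +-cancelˡ; ∙-cancelʳ to +-cancelʳ)
open import Algebra.Properties.Semiring.Mult
  (CommutativeRing.semiring +-*-commutativeRing) using (×-homo-+; ×1-homo-*)
  renaming (_×_ to _·_)
open import Algebra.Properties.Semiring.Sum
  (CommutativeRing.semiring +-*-commutativeRing)

open +-*-Solver using (solve; _:+_; _:*_; :-_; _:=_; con)

private variable
  A : Set
  n r : ℕ

-- Rational numerals and fractions

-- Taken as an iterated sum of `1ℚ`, so that `ι (suc n)` unfolds to `1ℚ + ι n` and the homomorphism
-- laws are those of multiples in a semiring.
ι : ℕ → ℚ
ι n = n · 1ℚ

ι-+ : ∀ m n → ι (m ℕ.+ n) ≡ ι m + ι n
ι-+ = ×-homo-+ 1ℚ

ι-* : ∀ m n → ι (m ℕ.* n) ≡ ι m * ι n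
ι-* = ×1-homo-*

0≤ι : ∀ n → 0ℚ ≤ ι n
0≤ι zero    = ≤-refl
0≤ι (suc n) = +-mono-≤ {0ℚ} {1ℚ} (nonNegative⁻¹ 1ℚ) (0≤ι n)

ι-mono-≤ : ∀ {m n} → m ℕ.≤ n → ι m ≤ ι n
ι-mono-≤ {n = n} z≤n = 0≤ι n
ι-mono-≤ (s≤s m≤n)   = +-monoʳ-≤ 1ℚ (ι-mono-≤ m≤n)

ι-mono-< : ∀ {m n} → m ℕ.< n → ι m < ι n
ι-mono-< {m} m<n = <-≤-trans
  (subst (_< ι (suc m)) (+-identityˡ (ι m)) (+-monoˡ-< (ι m) (positive⁻¹ 1ℚ)))
  (ι-mono-≤ m<n)

ι-injective : ∀ {m n} → ι m ≡ ι n → m ≡ n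
ι-injective {m} {n} eq with ℕ.<-cmp m n
... | tri< m<n _ _ = contradiction (ι-mono-< m<n) (<-irrefl eq)
... | tri≈ _ m≡n _ = m≡n
... | tri> _ _ n<m = contradiction (ι-mono-< n<m) (<-irrefl (sym eq))

ι-pos : ∀ n .{{_ : ℕ.NonZero n}} → Positive (ι n)
ι-pos (suc n) = positive (ι-mono-< {0} {suc n} (s≤s z≤n))

toℚᵘ-/ : ∀ a b → toℚᵘ (+ a / suc b) ℚᵘ.≃ ℚᵘ.mkℚᵘ (+ a) b
toℚᵘ-/ a b = toℚᵘ-fromℚᵘ (ℚᵘ.mkℚᵘ (+ a) b)

toℚᵘ-ι : ∀ n → toℚᵘ (ι n) ℚᵘ.≃ ℚᵘ.mkℚᵘ (+ n) 0
toℚᵘ-ι zero    = ℚᵘ.≃-refl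
toℚᵘ-ι (suc n) = begin-equality
  toℚᵘ (1ℚ + ι n)                     ≃⟨ toℚᵘ-homo-+ 1ℚ (ι n) ⟩
  toℚᵘ 1ℚ ℚᵘ.+ toℚᵘ (ι n)             ≃⟨ ℚᵘ.+-congʳ (toℚᵘ 1ℚ) (toℚᵘ-ι n) ⟩
  toℚᵘ 1ℚ ℚᵘ.+ ℚᵘ.mkℚᵘ (+ n) 0        ≃⟨ ℚᵘ.*≡* (cong (ℤ._* + 1) (cong (ℤ._+_ ℤ.1ℤ) (ℤ.*-identityʳ (+ n)))) ⟩
  ℚᵘ.mkℚᵘ (+ suc n) 0                 ∎
  where open ℚᵘ.≤-Reasoning

/-*-cancel : ∀ a b .{{_ : ℕ.NonZero b}} → (+ a / b) * ι b ≡ ι a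
/-*-cancel a (suc b) = toℚᵘ-injective (begin-equality
  toℚᵘ ((+ a / suc b) * ι (suc b))                ≃⟨ toℚᵘ-homo-* (+ a / suc b) (ι (suc b)) ⟩
  toℚᵘ (+ a / suc b) ℚᵘ.* toℚᵘ (ι (suc b))        ≃⟨ ℚᵘ.*-cong (toℚᵘ-/ a b) (toℚᵘ-ι (suc b)) ⟩
  ℚᵘ.mkℚᵘ (+ a) b ℚᵘ.* ℚᵘ.mkℚᵘ (+ suc b) 0        ≃⟨ ℚᵘ.*≡* (ℤ.*-assoc (+ a) (+ suc b) (+ 1)) ⟩
  ℚᵘ.mkℚᵘ (+ a) 0                                 ≃⟨ toℚᵘ-ι a ⟨
  toℚᵘ (ι a)                                      ∎)
  where open ℚᵘ.≤-Reasoning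

/-mono-≤ : ∀ a b c d .{{_ : ℕ.NonZero b}} .{{_ : ℕ.NonZero d}} →
           a ℕ.* d ℕ.≤ c ℕ.* b → + a / b ≤ + c / d
/-mono-≤ a (suc b) c (suc d) ad≤cb = toℚᵘ-cancel-≤ (begin
  toℚᵘ (+ a / suc b)   ≃⟨ toℚᵘ-/ a b ⟩
  ℚᵘ.mkℚᵘ (+ a) b
    ≤⟨ ℚᵘ.*≤* (subst₂ ℤ._≤_ (ℤ.pos-* a (suc d)) (ℤ.pos-* c (suc b)) (ℤ.+≤+ ad≤cb)) ⟩
  ℚᵘ.mkℚᵘ (+ c) d      ≃⟨ toℚᵘ-/ c d ⟨
  toℚᵘ (+ c / suc d)   ∎)
  where open ℚᵘ.≤-Reasoning

-- With `k = m + 1`, cross-multiplication leaves `d + m d ≤ m + d m`, which is `d ≤ m`.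
k/[k∸1]-anti : ∀ k {d} .{{_ : ℕ.NonZero (k ∸ 1)}} .{{_ : ℕ.NonZero d}} →
               suc d ℕ.≤ k → + k / (k ∸ 1) ≤ + suc d / d
k/[k∸1]-anti (suc m) {d} (s≤s d≤m) = /-mono-≤ (suc m) m (suc d) d
  (ℕ.+-mono-≤ d≤m (ℕ.≤-reflexive (ℕ.*-comm m d)))

*-cancelʳ-≡-pos : ∀ {p q} s .{{_ : Positive s}} → p * s ≡ q * s → p ≡ q
*-cancelʳ-≡-pos s eq = ≤-antisym
  (*-cancelʳ-≤-pos s (≤-reflexive eq))
  (*-cancelʳ-≤-pos s (≤-reflexive (sym eq)))

-- Sums over lists

-- Summing over positions makes the laws for sums over `Fin`, such as `∑-comm` and `∑-distrib-+`,
-- available for lists.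
∑∈ : List A → (A → ℚ) → ℚ
∑∈ xs f = sum (f ∘ List.lookup xs)

∑∈-cong : (xs : List A) {f g : A → ℚ} → f ≗ g → ∑∈ xs f ≡ ∑∈ xs g
∑∈-cong xs f≗g = sum-cong-≗ (f≗g ∘ List.lookup xs)

∑∈-++ : (xs ys : List A) (f : A → ℚ) → ∑∈ (xs ++ ys) f ≡ ∑∈ xs f + ∑∈ ys f
∑∈-++ []       ys f = sym (+-identityˡ _)
∑∈-++ (x ∷ xs) ys f =
  trans (cong (_+_ (f x)) (∑∈-++ xs ys f)) (sym (+-assoc (f x) _ _))

∑∈-↭ : {xs ys : List A} (f : A → ℚ) → xs ↭ ys → ∑∈ xs f ≡ ∑∈ ys f
∑∈-↭ f ↭.refl        = refl
∑∈-↭ f (prep x p)    = cong (_+_ (f x)) (∑∈-↭ f p)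
∑∈-↭ f (swap {xs = xs} {ys = ys} x y p) = begin
  f x + (f y + ∑∈ xs f)   ≡⟨ +-assoc (f x) (f y) _ ⟨
  f x + f y + ∑∈ xs f     ≡⟨ cong₂ _+_ (+-comm (f x) (f y)) (∑∈-↭ f p) ⟩
  f y + f x + ∑∈ ys f     ≡⟨ +-assoc (f y) (f x) _ ⟩
  f y + (f x + ∑∈ ys f)   ∎
  where open ≡-Reasoning
∑∈-↭ f (↭.trans p q) = trans (∑∈-↭ f p) (∑∈-↭ f q)

∑∈-tabulate : (g : Fin n → A) (f : A → ℚ) → ∑∈ (tabulate g) f ≡ sum (f ∘ g)
∑∈-tabulate {zero}  g f = refl
∑∈-tabulate {suc n} g f = cong (_+_ (f (g zero))) (∑∈-tabulate (g ∘ suc) f)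

∑∈-≤ : {xs : List A} {f : A → ℚ} {b : ℚ} →
       All (λ x → f x ≤ b) xs → ∑∈ xs f ≤ ι (length xs) * b
∑∈-≤ {b = b} []       = ≤-reflexive (sym (*-zeroˡ b))
∑∈-≤ {b = b} (_∷_ {xs = xs} p ps) = subst (_ ≤_)
  (solve 2 (λ l b → b :+ l :* b := (con 1ℚ :+ l) :* b) refl (ι (length xs)) b)
  (+-mono-≤ p (∑∈-≤ ps))

∑∈-< : {xs : List A} {f : A → ℚ} {b : ℚ} →
       All (λ x → f x ≤ b) xs → Any (λ x → f x < b) xs →
       ∑∈ xs f < ι (length xs) * b
∑∈-< {b = b} (_∷_ {xs = xs} p ps) q = subst (_ <_)
  (solve 2 (λ l b → b :+ l :* b := (con 1ℚ :+ l) :* b) refl (ι (length xs)) b)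
  (step q)
  where
  step : Any _ _ → _
  step (here p<)  = +-mono-<-≤ p< (∑∈-≤ ps)
  step (there q<) = +-mono-≤-< p (∑∈-< ps q<)

-- Finite sums, squares and the indicator of equality

sum-const : ∀ n (x : ℚ) → ∑[ i < n ] x ≡ ι n * x
sum-const zero    x = sym (*-zeroˡ x)
sum-const (suc n) x = trans (cong (_+_ x) (sum-const n x))
  (solve 2 (λ l x → x :+ l :* x := (con 1ℚ :+ l) :* x) refl (ι n) x)

sum-nonNeg : (f : Fin n → ℚ) → (∀ i → 0ℚ ≤ f i) → 0ℚ ≤ sum f
sum-nonNeg {zero}  f 0≤f = ≤-refl
sum-nonNeg {suc n} f 0≤f =
  +-mono-≤ {0ℚ} {f zero} (0≤f zero) (sum-nonNeg (f ∘ suc) (0≤f ∘ suc))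

sum≡0⇒≡0 : (f : Fin n → ℚ) → (∀ i → 0ℚ ≤ f i) → sum f ≡ 0ℚ → ∀ i → f i ≡ 0ℚ
sum≡0⇒≡0 f 0≤f eq i = ≤-antisym (bound f 0≤f (≤-reflexive eq) i) (0≤f i)
  where
  bound : ∀ {n} (f : Fin n → ℚ) → (∀ i → 0ℚ ≤ f i) → sum f ≤ 0ℚ → ∀ i → f i ≤ 0ℚ
  bound f 0≤f s≤0 zero    = ≤-trans
    (subst (_≤ sum f) (+-identityʳ (f zero))
      (+-monoʳ-≤ (f zero) (sum-nonNeg (f ∘ suc) (0≤f ∘ suc)))) s≤0
  bound f 0≤f s≤0 (suc i) = bound (f ∘ suc) (0≤f ∘ suc)
    (≤-trans (subst (_≤ sum f) (+-identityˡ _)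
      (+-monoˡ-≤ (sum (f ∘ suc)) (0≤f zero))) s≤0) i

0≤p² : ∀ p → 0ℚ ≤ p * p
0≤p² p with ≤-total 0ℚ p
... | inj₁ 0≤p = subst (_≤ p * p) (*-zeroˡ p)
                   (*-monoʳ-≤-nonNeg p {{nonNegative 0≤p}} 0≤p)
... | inj₂ p≤0 = subst (_≤ p * p) (*-zeroˡ p)
                   (*-monoʳ-≤-nonPos p {{nonPositive p≤0}} p≤0)

p²≡0⇒p≡0 : ∀ p → p * p ≡ 0ℚ → p ≡ 0ℚ
p²≡0⇒p≡0 p p²≡0 with <-cmp p 0ℚ
... | tri≈ _ p≡0 _ = p≡0
... | tri< p<0 _ _ = contradiction
  (subst (_< p * p) (*-zeroˡ p) (*-monoˡ-<-neg p {{negative p<0}} p<0))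
  (<-irrefl (sym p²≡0))
... | tri> _ _ 0<p = contradiction
  (subst (_< p * p) (*-zeroˡ p) (*-monoˡ-<-pos p {{positive 0<p}} 0<p))
  (<-irrefl (sym p²≡0))

δ : Fin r → Fin r → ℚ
δ i j = if does (i Fin.≟ j) then 1ℚ else 0ℚ

δ-≡ : {i j : Fin r} → i ≡ j → δ i j ≡ 1ℚ
δ-≡ {i = i} {j} i≡j = cong (if_then 1ℚ else 0ℚ) (dec-true (i Fin.≟ j) i≡j)

δ-≢ : {i j : Fin r} → i ≢ j → δ i j ≡ 0ℚ
δ-≢ {i = i} {j} i≢j = cong (if_then 1ℚ else 0ℚ) (dec-false (i Fin.≟ j) i≢j)

sum-δ : (i : Fin r) (f : Fin r → ℚ) → ∑[ j < r ] (δ i j * f j) ≡ f i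
sum-δ {suc r} zero f = begin
  1ℚ * f zero + ∑[ j < r ] (0ℚ * f (suc j))
    ≡⟨ cong₂ _+_ (*-identityˡ (f zero))
         (trans (sum-cong-≗ (*-zeroˡ ∘ f ∘ suc)) (trans (sum-const r 0ℚ) (*-zeroʳ (ι r)))) ⟩
  f zero + 0ℚ ≡⟨ +-identityʳ (f zero) ⟩
  f zero ∎
  where open ≡-Reasoning
sum-δ (suc i) f = trans (cong₂ _+_ (*-zeroˡ (f zero)) (sum-δ i (f ∘ suc))) (+-identityˡ _)

-- Cliques and weights

largest-unique : {P Q : ℕ → Set₁} {k l : ℕ} → (∀ {m} → P m → Q m) →
                 (∀ {m} → Q m → P m) → IsLargest P k → IsLargest Q l → k ≡ l
largest-unique P⇒Q Q⇒P (pk , k-max) (ql , l-max) =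
  ℕ.≤-antisym (l-max (P⇒Q pk)) (k-max (Q⇒P ql))

AllPairs-lookup : {R : A → A → Set} → Symmetric R → {xs : List A} →
                  AllPairs R xs → ∀ i j → i ≢ j →
                  R (List.lookup xs i) (List.lookup xs j)
AllPairs-lookup s (p ∷ ps) zero    zero    i≢j = contradiction refl i≢j
AllPairs-lookup s (p ∷ ps) zero    (suc j) i≢j = All.lookup p (∈-lookup j)
AllPairs-lookup s (p ∷ ps) (suc i) zero    i≢j = s (All.lookup p (∈-lookup i))
AllPairs-lookup s (p ∷ ps) (suc i) (suc j) i≢j =
  AllPairs-lookup s ps i j (i≢j ∘ cong suc)

split-∈ : {x : A} {xs : List A} → x ∈ xs → ∃ λ ys → xs ↭ x ∷ ys
split-∈ {x = x} x∈xs with ∈-∃++ x∈xs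
... | ys , zs , refl = ys ++ zs , shift x ys zs

-- From sums over edges to sums over ordered pairs

module EdgeWeight {n : ℕ} (G : Graph n) (w : ∀ {u v} → Adj G u v → ℚ)
  (w-sym : ∀ {u v} (p : Adj G u v) (q : Adj G v u) → w p ≡ w q) where

  W : Fin n → Fin n → ℚ
  W u v with adj? G u v
  ... | yes uv = w uv
  ... | no  _  = 0ℚ

  W-adj : ∀ {u v} (uv : Adj G u v) → W u v ≡ w uv
  W-adj {u} {v} uv with adj? G u v
  -- Passing through the reversed edge compares two proofs of the same adjacency, so symmetry of `w`
  -- also gives independence of the proof.
  ... | yes uv′ = trans (w-sym uv′ (adj-sym G uv)) (w-sym (adj-sym G uv) uv)
  ... | no  ¬uv = contradiction uv ¬uv

  W-nonadj : ∀ {u v} → ¬ Adj G u v → W u v ≡ 0ℚ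
  W-nonadj {u} {v} ¬uv with adj? G u v
  ... | yes uv = contradiction uv ¬uv
  ... | no  _  = refl

  W-sym : ∀ u v → W u v ≡ W v u
  W-sym u v with adj? G u v
  ... | yes uv = trans (w-sym uv (adj-sym G uv)) (sym (W-adj (adj-sym G uv)))
  ... | no ¬uv = sym (W-nonadj (¬uv ∘ adj-sym G))

  edgeTerm-< : ∀ {u v} → u Fin.< v → edgeTerm G w u v ≡ W u v
  edgeTerm-< {u} {v} u<v with u Fin.<? v | adj? G u v
  ... | yes _   | yes _ = refl
  ... | yes _   | no  _ = refl
  ... | no  u≮v | _     = contradiction u<v u≮v

  edgeTerm-≮ : ∀ {u v} → ¬ u Fin.< v → edgeTerm G w u v ≡ 0ℚ
  edgeTerm-≮ {u} {v} u≮v with u Fin.<? v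
  ... | yes u<v = contradiction u<v u≮v
  ... | no  _   = refl

  -- Off the diagonal exactly one of the two orientations is counted; on the diagonal neither is,
  -- and `W` vanishes by irreflexivity.
  edgeTerms : ∀ u v → edgeTerm G w u v + edgeTerm G w v u ≡ W u v
  edgeTerms u v with Fin.<-cmp u v
  ... | tri< u<v _ v≮u =
    trans (cong₂ _+_ (edgeTerm-< u<v) (edgeTerm-≮ v≮u)) (+-identityʳ _)
  ... | tri> u≮v _ v<u =
    trans (cong₂ _+_ (edgeTerm-≮ u≮v) (edgeTerm-< v<u))
          (trans (+-identityˡ _) (W-sym v u))
  ... | tri≈ u≮u refl _ =
    trans (cong₂ _+_ (edgeTerm-≮ u≮u) (edgeTerm-≮ u≮u)) (sym (W-nonadj (irrefl G)))

  total : ℚ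
  total = ∑[ u < n ] ∑[ v < n ] W u v

  -- Adding the sum to its own transpose visits every ordered pair once.
  edgeSum-total : edgeSum G w * ι 2 ≡ total
  edgeSum-total = begin
    S * ι 2 ≡⟨ solve 1 (λ s → s :* con (ι 2) := s :+ s) refl S ⟩
    S + S   ≡⟨ cong (_+_ S) (∑-comm e) ⟩
    S + ∑[ u < n ] ∑[ v < n ] e v u
      ≡⟨ ∑-distrib-+ (λ u → ∑[ v < n ] e u v) (λ u → ∑[ v < n ] e v u) ⟨
    ∑[ u < n ] (∑[ v < n ] e u v + ∑[ v < n ] e v u)
      ≡⟨ sum-cong-≗ (λ u → trans (sym (∑-distrib-+ (e u) (flip e u)))
                                 (sum-cong-≗ (edgeTerms u))) ⟩
    total   ∎
    where
    open ≡-Reasoning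
    e = edgeTerm G w
    S = edgeSum G w

  degree : Fin n → List (Fin n) → ℕ
  degree v K = length (filter (adj? G v) K)

  row-filter : ∀ v K → ∑∈ K (W v) ≡ ∑∈ (filter (adj? G v) K) (W v)
  row-filter v []      = refl
  row-filter v (y ∷ K) = step (adj? G v y)
    where
    step : Dec (Adj G v y) →
           ∑∈ (y ∷ K) (W v) ≡ ∑∈ (filter (adj? G v) (y ∷ K)) (W v)
    step (yes vy) = trans (cong (_+_ (W v y)) (row-filter v K))
      (cong (λ N → ∑∈ N (W v)) (sym (List.filter-accept (adj? G v) vy)))
    step (no ¬vy) = trans
      (trans (cong₂ _+_ (W-nonadj ¬vy) (row-filter v K)) (+-identityˡ _))
      (cong (λ N → ∑∈ N (W v)) (sym (List.filter-reject (adj? G v) ¬vy)))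

-- Weight of the edges from a vertex into a clique

module _ {n : ℕ} (G : Graph n) where

  Clique : List (Fin n) → Set
  Clique = AllPairs (Adj G)

  -- Maximality of a clique, stated vertex by vertex. Members of `K` satisfy it as their own
  -- non-neighbours, so that members and outsiders are bounded alike.
  NonNbrIn : List (Fin n) → Fin n → Set
  NonNbrIn K v = Any (∁ (Adj G v)) K

  edgeOfK-sym : ∀ {u v k} → EdgeOfK G u v k → EdgeOfK G v u k
  edgeOfK-sym (H , iso , e) = H , iso , edge-sym H e

  -- The value of `c` is computed from an adjacency proof; maximality over the same set of clique
  -- sizes makes it independent of that proof and of the orientation.
  c-sym : ∀ {u v} (p : Adj G u v) (q : Adj G v u) → c G p ≡ c G q
  c-sym p q = largest-unique edgeOfK-sym edgeOfK-sym
                             (c-isLargest G p) (c-isLargest G q)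

  weight-sym : ∀ {u v} (p : Adj G u v) (q : Adj G v u) → weight G p ≡ weight G q
  weight-sym p q = /-cong {{c∸1-nonZero G p}} {{c∸1-nonZero G q}}
                          (cong +_ (c-sym p q)) (cong (_∸ 1) (c-sym p q))

  open EdgeWeight G (weight G) weight-sym

  -- The list itself is the witness: `u` sits at position zero and `v` one past its position in `L`.
  clique-≤c : ∀ {L u v} → Clique (u ∷ L) → v ∈ L → (uv : Adj G u v) →
              suc (length L) ℕ.≤ c G uv
  clique-≤c {L} {u} {v} cl v∈L uv = proj₂ (c-isLargest G uv) (clique⇒edgeOfK G
    (Vec.tabulate f , clq , zero , suc (Any.index v∈L) , (λ ()) , refl ,
     trans (Vec.lookup∘tabulate f (suc (Any.index v∈L)))
           (sym (Any.lookup-index v∈L))))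
    where
    f = List.lookup (u ∷ L)
    clq : ∀ i j → i ≢ j → Adj G (Vec.lookup (Vec.tabulate f) i)
                                (Vec.lookup (Vec.tabulate f) j)
    clq i j i≢j = subst₂ (Adj G)
      (sym (Vec.lookup∘tabulate f i)) (sym (Vec.lookup∘tabulate f j))
      (AllPairs-lookup (adj-sym G) cl i j i≢j)

  weight-≤ : ∀ {u v} d .{{_ : ℕ.NonZero d}} (uv : Adj G u v) →
             suc d ℕ.≤ c G uv → weight G uv ≤ + suc d / d
  weight-≤ d uv d<c = k/[k∸1]-anti (c G uv) {{c∸1-nonZero G uv}} d<c

  row-≤ : ∀ v {K} → Clique K → ∑∈ K (W v) ≤ ι (suc (degree v K))
  row-≤ v {K} cl = subst (_≤ ι (suc (degree v K))) (sym (row-filter v K))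
    (bound (filter (adj? G v) K) (All.all-filter (adj? G v) K)
           (AllPairs.filter⁺ (adj? G v) cl))
    where
    bound : ∀ N → All (Adj G v) N → Clique N → ∑∈ N (W v) ≤ ι (suc (length N))
    -- The fraction `(d + 1) / d` needs `d` nonzero; without neighbours the row is zero and the
    -- bound `1` is slack.
    bound []         _  _   = 0≤ι 1
    bound N@(_ ∷ _) vN clN = subst (∑∈ N (W v) ≤_)
      (trans (*-comm (ι d) (+ suc d / d)) (/-*-cancel (suc d) d))
      (∑∈-≤ (All.tabulate λ {y} y∈N → let vy = All.lookup vN y∈N in
        subst (_≤ + suc d / d) (sym (W-adj vy)) (weight-≤ d vy (clique-≤c (vN ∷ clN) y∈N vy))))
      where d = length N

  -- A non-neighbour in `K` makes the degree smaller than `length K`, which absorbs the extra one in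
  -- `row-≤`.
  row-≤-length : ∀ v {K} → Clique K → NonNbrIn K v → ∑∈ K (W v) ≤ ι (length K)
  row-≤-length v {K} cl nn =
    ≤-trans (row-≤ v cl) (ι-mono-≤ (List.filter-notAll (adj? G v) K nn))

  -- Peeling off maximal cliques

  -- Greedy scan: a vertex adjacent to the whole current clique joins it, any other goes to `R`. A
  -- rejected vertex keeps its non-neighbour because the clique only grows.
  extend-clique′ : ∀ {K} → Clique K → ∀ xs → ∃₂ λ L R →
    Clique (L ++ K) × (K ++ xs ↭ (L ++ K) ++ R) × All (NonNbrIn (L ++ K)) R
  extend-clique′ cl [] = [] , [] , cl , ↭.refl , []
  extend-clique′ {K} cl (x ∷ xs) with all? (adj? G x) K
  ... | yes xK with extend-clique′ (xK ∷ cl) xs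
  ...   | L , R , cl′ , p , nn
        rewrite sym (List.++-assoc L [ x ] K) =
        L ++ [ x ] , R , cl′ , ↭-trans (shift x K xs) p , nn
  extend-clique′ {K} cl (x ∷ xs) | no ¬xK with extend-clique′ cl xs
  ... | L , R , cl′ , p , nn =
    L , x ∷ R , cl′ ,
    ↭-trans (shift x K xs) (↭-trans (prep x p) (↭-sym (shift x (L ++ K) R))) ,
    Any.++⁺ʳ L (All.¬All⇒Any¬ (adj? G x) K ¬xK) ∷ nn

  -- The given clique survives as a suffix, so a maximal clique can be made to contain a prescribed
  -- vertex (for the induction) or a prescribed edge (for the equality case).
  extend-clique : ∀ {K} → Clique K → ∀ xs → ∃₂ λ L R →
    Clique (L ++ K) × (K ++ xs ↭ (L ++ K) ++ R) ×
    All (NonNbrIn (L ++ K)) (K ++ xs)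
  extend-clique {K} cl xs with extend-clique′ cl xs
  ... | L , R , cl′ , p , nn =
    L , R , cl′ , p , All-resp-↭ (↭-sym p) (All.++⁺ (All.tabulate self) nn)
    where
    self : ∀ {v} → v ∈ L ++ K → NonNbrIn (L ++ K) v
    self {v} = Any.map λ eq → irrefl G ∘ subst (Adj G v) (sym eq)

  -- Block sums and the quadratic bound

  block : List (Fin n) → List (Fin n) → ℚ
  block xs ys = ∑∈ xs (λ x → ∑∈ ys (W x))

  block-sym : ∀ xs ys → block xs ys ≡ block ys xs
  block-sym xs ys = trans
    (∑-comm (λ i j → W (List.lookup xs i) (List.lookup ys j)))
    (∑∈-cong ys (λ y → ∑∈-cong xs (λ x → W-sym x y)))

  -- The columns in `K` are split off first, then the rows of the rest. The corner `block K R` is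
  -- reflected so that `K` always indexes columns, where `block-≤` applies.
  block-split : ∀ {xs} K R → xs ↭ K ++ R →
                block xs xs ≡ block xs K + (block R K + block R R)
  block-split {xs} K R p = begin
    block xs xs
      ≡⟨ ∑∈-cong xs (λ x → trans (∑∈-↭ (W x) p) (∑∈-++ K R (W x))) ⟩
    ∑∈ xs (λ x → ∑∈ K (W x) + ∑∈ R (W x))
      ≡⟨ ∑-distrib-+ (λ i → ∑∈ K (W (List.lookup xs i))) (row ∘ List.lookup xs) ⟩
    block xs K + block xs R
      ≡⟨ cong (_+_ (block xs K)) (trans (∑∈-↭ row p) (∑∈-++ K R row)) ⟩
    block xs K + (block K R + block R R)
      ≡⟨ cong (λ z → block xs K + (z + block R R)) (block-sym K R) ⟩
    block xs K + (block R K + block R R) ∎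
    where
    open ≡-Reasoning
    row : Fin n → ℚ
    row x = ∑∈ R (W x)

  ∣_∣ : List (Fin n) → ℚ
  ∣ xs ∣ = ι (length xs)

  -- The bounds for the three pieces of `block-split` add up to the square exactly, so a single
  -- strict row makes the whole bound strict.
  square-split : ∀ {xs : List (Fin n)} K R → xs ↭ K ++ R →
                 ∣ xs ∣ * ∣ K ∣ + (∣ R ∣ * ∣ K ∣ + ∣ R ∣ * ∣ R ∣) ≡ ∣ xs ∣ * ∣ xs ∣
  square-split {xs} K R p
    rewrite trans (↭-length p) (List.length-++ K {R}) | ι-+ (length K) (length R) =
    solve 2 (λ k r → (k :+ r) :* k :+ (r :* k :+ r :* r) := (k :+ r) :* (k :+ r))
      refl ∣ K ∣ ∣ R ∣

  block-≤ : ∀ xs {K} → Clique K → All (NonNbrIn K) xs →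
            block xs K ≤ ∣ xs ∣ * ∣ K ∣
  block-≤ xs {K} cl nn = ∑∈-≤ {xs = xs} {λ v → ∑∈ K (W v)} (All.map (λ {v} → row-≤-length v cl) nn)

  NonNbr-rest : ∀ {xs : List (Fin n)} K {R} → xs ↭ K ++ R →
                All (NonNbrIn K) xs → All (NonNbrIn K) R
  NonNbr-rest K p nn = All.++⁻ʳ K (All-resp-↭ p nn)

  -- Induction on a bound for the length, since `R` is not structurally smaller than the list.
  -- Growing the clique from the head makes `R` strictly shorter.
  square-≤-fuel : ∀ k xs → length xs ℕ.≤ k → block xs xs ≤ ∣ xs ∣ * ∣ xs ∣
  square-≤-fuel k       []       _          = ≤-refl
  square-≤-fuel (suc k) (x ∷ xs) (s≤s xs≤k) =
    let L , R , cl , p , nn = extend-clique {[ x ]} ([] ∷ []) xs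
        K = L ++ [ x ]
    in subst₂ _≤_ (sym (block-split K R p)) (square-split K R p)
      (+-mono-≤ (block-≤ (x ∷ xs) cl nn)
        (+-mono-≤ (block-≤ R cl (NonNbr-rest K p nn))
          (square-≤-fuel k R (ℕ.≤-trans (rest-≤ L R p) xs≤k))))
    where
    rest-≤ : ∀ L R → x ∷ xs ↭ (L ++ [ x ]) ++ R → length R ℕ.≤ length xs
    rest-≤ L R p = ℕ.s≤s⁻¹ (begin
      suc (length R)                   ≤⟨ ℕ.m≤n+m _ (length L) ⟩
      length L ℕ.+ suc (length R)      ≡⟨ ℕ.+-assoc (length L) 1 (length R) ⟨
      length L ℕ.+ 1 ℕ.+ length R      ≡⟨ cong (ℕ._+ length R) (List.length-++ L) ⟨
      length (L ++ [ x ]) ℕ.+ length R ≡⟨ List.length-++ (L ++ [ x ]) ⟨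
      length ((L ++ [ x ]) ++ R)       ≡⟨ ↭-length p ⟨
      suc (length xs)                  ∎)
      where open ℕ.≤-Reasoning

  square-≤ : ∀ xs → block xs xs ≤ ∣ xs ∣ * ∣ xs ∣
  square-≤ xs = square-≤-fuel (length xs) xs ℕ.≤-refl

  square-< : ∀ {xs} K R → Clique K → xs ↭ K ++ R → All (NonNbrIn K) xs →
             Any (λ v → ∑∈ K (W v) < ∣ K ∣) xs → block xs xs < ∣ xs ∣ * ∣ xs ∣
  square-< {xs} K R cl p nn strict =
    subst₂ _<_ (sym (block-split K R p)) (square-split K R p)
      (+-mono-<-≤
        (∑∈-< {xs = xs} {λ v → ∑∈ K (W v)} (All.map (λ {v} → row-≤-length v cl) nn) strict)
        (+-mono-≤ (block-≤ R cl (NonNbr-rest K p nn)) (square-≤ R)))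

  -- The whole vertex set and the case of equality

  vertices : List (Fin n)
  vertices = List.allFin n

  block-vertices : block vertices vertices ≡ total
  block-vertices = trans (∑∈-tabulate id (λ x → ∑∈ vertices (W x)))
                         (sum-cong-≗ (λ x → ∑∈-tabulate id (W x)))

  ∣vertices∣ : ∣ vertices ∣ ≡ ι n
  ∣vertices∣ = cong ι {length vertices} {n} (List.length-tabulate id)

  total-≤ : total ≤ ι n * ι n
  total-≤ = subst₂ _≤_ block-vertices (cong₂ _*_ ∣vertices∣ ∣vertices∣)
                       (square-≤ vertices)

  -- Two non-neighbours push the degree at least two below the length of the clique, so the extra
  -- one in `row-≤` still leaves a gap.
  row-<-length : ∀ {u v w} L → Clique (L ++ u ∷ [ w ]) → ¬ Adj G v u → ¬ Adj G v w →
                 ∑∈ (L ++ u ∷ [ w ]) (W v) < ∣ L ++ u ∷ [ w ] ∣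
  row-<-length {u} {v} {w} L cl ¬vu ¬vw = ≤-<-trans (row-≤ v cl) (ι-mono-< (begin
    2 ℕ.+ length (N (L ++ u ∷ [ w ])) ≡⟨ cong (λ z → 2 ℕ.+ length z) drop-uw ⟩
    2 ℕ.+ length (N L)                ≤⟨ ℕ.+-monoʳ-≤ 2 (List.length-filter (adj? G v) L) ⟩
    2 ℕ.+ length L                    ≡⟨ ℕ.+-comm 2 (length L) ⟩
    length L ℕ.+ 2                    ≡⟨ List.length-++ L ⟨
    length (L ++ u ∷ [ w ])           ∎))
    where
    open ℕ.≤-Reasoning
    N = filter (adj? G v)
    drop-uw : N (L ++ u ∷ [ w ]) ≡ N L
    drop-uw = trans (List.filter-++ (adj? G v) L (u ∷ [ w ]))
      (trans (cong (N L ++_) (List.filter-none (adj? G v) (¬vu ∷ ¬vw ∷ [])))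
             (List.++-identityʳ (N L)))

  nonAdj-trans : total ≡ ι n * ι n → ∀ {u v w} →
                 ¬ Adj G u v → ¬ Adj G v w → ¬ Adj G u w
  nonAdj-trans eq {u} {v} {w} ¬uv ¬vw uw =
    -- The vertex list is rearranged to begin with `u` and `w`; irreflexivity places `w` in the tail
    -- after `u`.
    let ys , p = split-∈ (∈-allFin {n} u)
        zs , q = split-∈ (Any.tail (λ { refl → irrefl G uw })
                                   (Any-resp-↭ p (∈-allFin {n} w)))
        L , R , cl , s , nn = extend-clique {u ∷ [ w ]} ((uw ∷ []) ∷ [] ∷ []) zs
        t = ↭-trans p (prep u q)
    in <-irrefl
      (trans block-vertices (trans eq (sym (cong₂ _*_ ∣vertices∣ ∣vertices∣))))
      (square-< (L ++ u ∷ [ w ]) R cl (↭-trans t s) (All-resp-↭ (↭-sym t) nn)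
        (Any.map (λ { refl → row-<-length L cl (¬uv ∘ adj-sym G) ¬vw }) (∈-allFin v)))

-- Complete multipartite graphs

module PartSizes {n r : ℕ} (part : Fin n → Fin r) where

  -- A sum of indicators, so that it can be interchanged with other sums.
  size : Fin r → ℚ
  size i = ∑[ v < n ] δ (part v) i

  ι-partSize : ∀ i → ι (partSize part i) ≡ size i
  ι-partSize i = count-tabulate id
    where
    count-tabulate : ∀ {m} (g : Fin m → Fin n) →
      ι (Vec.count (λ v → part v Fin.≟ i) (Vec.tabulate g)) ≡
      ∑[ k < m ] δ (part (g k)) i
    count-tabulate {zero}  g = refl
    count-tabulate {suc m} g with does (part (g zero) Fin.≟ i)
    ... | true  = cong (_+_ 1ℚ) (count-tabulate (g ∘ suc))
    ... | false = trans (count-tabulate (g ∘ suc)) (sym (+-identityˡ _))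

  sum-fibres : (f : Fin r → ℚ) → ∑[ v < n ] f (part v) ≡ ∑[ i < r ] (size i * f i)
  sum-fibres f = begin
    ∑[ v < n ] f (part v)
      ≡⟨ sum-cong-≗ (λ v → sym (sum-δ (part v) f)) ⟩
    ∑[ v < n ] ∑[ i < r ] (δ (part v) i * f i)
      ≡⟨ ∑-comm (λ v i → δ (part v) i * f i) ⟩
    ∑[ i < r ] ∑[ v < n ] (δ (part v) i * f i)
      ≡⟨ sum-cong-≗ (λ i → sym (*-distribʳ-sum (f i) (λ v → δ (part v) i))) ⟩
    ∑[ i < r ] (size i * f i) ∎
    where open ≡-Reasoning

  sum-size : ∑[ i < r ] size i ≡ ι n
  sum-size = begin
    ∑[ i < r ] size i        ≡⟨ sum-cong-≗ (λ i → sym (*-identityʳ (size i))) ⟩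
    ∑[ i < r ] (size i * 1ℚ) ≡⟨ sum-fibres (λ _ → 1ℚ) ⟨
    ∑[ v < n ] 1ℚ            ≡⟨ sum-const n 1ℚ ⟩
    ι n * 1ℚ                 ≡⟨ *-identityʳ (ι n) ⟩
    ι n                      ∎
    where open ≡-Reasoning

  sizeSq : ℚ
  sizeSq = ∑[ i < r ] (size i * size i)

  -- The squared deviations add up to `r` times `r sizeSq − n²`, which is zero, so each of them
  -- vanishes.
  sizes-equal : ι r * sizeSq ≡ ι n * ι n → ∀ i → ι r * size i ≡ ι n
  sizes-equal eq i = begin
    ι r * size i             ≡⟨ solve 2 (λ x y → x := (x :+ :- y) :+ y) refl (ι r * size i) (ι n) ⟩
    dev i + ι n              ≡⟨ cong (_+ ι n) (p²≡0⇒p≡0 (dev i) (sum≡0⇒≡0 _ (0≤p² ∘ dev) variance i)) ⟩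
    0ℚ + ι n                 ≡⟨ +-identityˡ (ι n) ⟩
    ι n                      ∎
    where
    open ≡-Reasoning
    R = ι r
    N = ι n
    dev : Fin r → ℚ
    dev i = R * size i + - N

    variance : ∑[ i < r ] (dev i * dev i) ≡ 0ℚ
    variance = begin
      ∑[ i < r ] (dev i * dev i)
        ≡⟨ sum-cong-≗ (λ i → solve 3
             (λ R N a → (R :* a :+ :- N) :* (R :* a :+ :- N) :=
                        R :* R :* (a :* a) :+ (:- (con (ι 2) :* (R :* N)) :* a :+ N :* N))
             refl R N (size i)) ⟩
      ∑[ i < r ] (R * R * (size i * size i) + (- (ι 2 * (R * N)) * size i + N * N))
        ≡⟨ ∑-distrib-+ (λ i → R * R * (size i * size i))
                       (λ i → - (ι 2 * (R * N)) * size i + N * N) ⟩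
      ∑[ i < r ] (R * R * (size i * size i)) +
      ∑[ i < r ] (- (ι 2 * (R * N)) * size i + N * N)
        ≡⟨ cong₂ _+_ (sym (*-distribˡ-sum (R * R) (λ i → size i * size i)))
             (trans (∑-distrib-+ (λ i → - (ι 2 * (R * N)) * size i) (λ _ → N * N))
               (cong₂ _+_ (sym (*-distribˡ-sum (- (ι 2 * (R * N))) size))
                          (sum-const r (N * N)))) ⟩
      R * R * sizeSq + (- (ι 2 * (R * N)) * sum size + R * (N * N))
        ≡⟨ cong₂ (λ x y → x + (- (ι 2 * (R * N)) * y + R * (N * N)))
             (trans (*-assoc R R sizeSq) (cong (R *_) eq)) sum-size ⟩
      R * (N * N) + (- (ι 2 * (R * N)) * N + R * (N * N))
        ≡⟨ solve 2 (λ R N → R :* (N :* N) :+ (:- (con (ι 2) :* (R :* N)) :* N :+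
                                              R :* (N :* N)) := con 0ℚ) refl R N ⟩
      0ℚ ∎

  const-size : ∀ {a} → (∀ i → size i ≡ a) → ι r * a ≡ ι n
  const-size {a} eq = trans (sym (sum-const r a)) (trans (sym (sum-cong-≗ eq)) sum-size)

  const-sizeSq : ∀ {a} → (∀ i → size i ≡ a) → ι r * sizeSq ≡ ι n * ι n
  const-sizeSq {a} eq = begin
    ι r * sizeSq        ≡⟨ cong (ι r *_) (trans (sum-cong-≗ (λ i → cong₂ _*_ (eq i) (eq i))) (sum-const r (a * a))) ⟩
    ι r * (ι r * (a * a)) ≡⟨ solve 2 (λ R a → R :* (R :* (a :* a)) := (R :* a) :* (R :* a)) refl (ι r) a ⟩
    (ι r * a) * (ι r * a) ≡⟨ cong₂ _*_ (const-size eq) (const-size eq) ⟩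
    ι n * ι n           ∎
    where open ≡-Reasoning

-- Classes of a transitive non-adjacency relation

module NonAdjacencyClasses {n : ℕ} (G : Graph n)
  (trans-¬adj : ∀ {u v w} → ¬ Adj G u v → ¬ Adj G v w → ¬ Adj G u w)
  (K : List (Fin n)) (clique : Clique G K) (nonNbr : ∀ v → NonNbrIn G K v) where

  rep : Fin (length K) → Fin n
  rep = List.lookup K

  -- It does not matter which non-neighbour is found: two of them would be non-adjacent by
  -- transitivity, while distinct positions of the clique hold adjacent vertices.
  part : Fin n → Fin (length K)
  part v = Any.index (nonNbr v)

  ¬rep : ∀ v → ¬ Adj G v (rep (part v))
  ¬rep v = Any.lookup-index (nonNbr v)

  rep-adj : ∀ {i j} → i ≢ j → Adj G (rep i) (rep j)
  rep-adj = AllPairs-lookup (adj-sym G) clique _ _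

  -- A clique vertex is adjacent to all the others, so its only non-neighbour in `K` is itself.
  part-rep : ∀ i → part (rep i) ≡ i
  part-rep i = decidable-stable (part (rep i) Fin.≟ i) λ ¬p →
    ¬rep (rep i) (rep-adj (¬p ∘ sym))

  part-≡ : ∀ {u v} → part u ≡ part v → ¬ Adj G u v
  part-≡ {u} {v} p = trans-¬adj (¬rep u)
    (subst (λ i → ¬ Adj G (rep i) v) (sym p) (¬rep v ∘ adj-sym G))

  -- If `u` and `v` were non-adjacent, the chain from one representative through `u` and `v` to the
  -- other would make the representatives non-adjacent.
  part-≢ : ∀ {u v} → part u ≢ part v → Adj G u v
  part-≢ {u} {v} p = decidable-stable (adj? G u v) λ ¬uv →
    trans-¬adj (trans-¬adj (¬rep u ∘ adj-sym G) ¬uv) (¬rep v) (rep-adj p)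

  complete : IsCompleteMultipartite G part
  complete u v = mk⇔ (λ uv p → part-≡ p uv) part-≢

  onto : ∀ i → ∃ λ v → part v ≡ i
  onto i = rep i , part-rep i

  nonadjacent : length K ℕ.< 2 → ∀ u v → ¬ Adj G u v
  nonadjacent r<2 u v = part-≡ (unique r<2 (part u) (part v))
    where
    unique : ∀ {r} → r ℕ.< 2 → (i j : Fin r) → i ≡ j
    unique {1}           _               zero zero = refl
    unique {suc (suc _)} (s≤s (s≤s ()))

-- Equality forces a complete multipartite graph

module _ {n : ℕ} (G : Graph n) where
  open EdgeWeight G (weight G) (weight-sym G)

  nonadjacent⇒total≡0 : (∀ u v → ¬ Adj G u v) → total ≡ 0ℚ
  nonadjacent⇒total≡0 ¬adj = trans (sum-cong-≗ (λ u → zeros (¬adj u))) zero-sum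
    where
    zero-sum : ∑[ v < n ] 0ℚ ≡ 0ℚ
    zero-sum = trans (sum-const n 0ℚ) (*-zeroʳ (ι n))
    zeros : ∀ {u} → (∀ v → ¬ Adj G u v) → sum (W u) ≡ 0ℚ
    zeros ¬u = trans (sum-cong-≗ (λ v → W-nonadj (¬u v))) zero-sum

  total≡n²⇒multipartite : .{{_ : ℕ.NonZero n}} → total ≡ ι n * ι n →
    ∃ λ r → 2 ℕ.≤ r × Σ[ part ∈ (Fin n → Fin r) ]
      (IsCompleteMultipartite G part × (∀ i → ∃ λ v → part v ≡ i))
  total≡n²⇒multipartite eq =
    let L , R , cl , _ , nn = extend-clique G {[]} [] (vertices G)
        module C = NonAdjacencyClasses G (nonAdj-trans G eq) (L ++ []) cl
                     (λ v → All.lookup nn (∈-allFin v))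
    in length (L ++ []) ,
       -- With fewer than two classes there are no edges, and the total would be zero instead of
       -- `n²`.
       ℕ.≮⇒≥ (λ r<2 → n²≢0 (trans (sym eq) (nonadjacent⇒total≡0 (C.nonadjacent r<2)))) ,
       C.part , C.complete , C.onto
    where
    n²≢0 : ι n * ι n ≢ 0ℚ
    n²≢0 n²≡0 = ℕ.≢-nonZero⁻¹ (n ℕ.* n) {{ℕ.m*n≢0 n n}}
      (ι-injective {n ℕ.* n} {0} (trans (ι-* n n) n²≡0))

-- The total weight of a complete multipartite graph with nonempty parts

module Multipartite {n r : ℕ} (G : Graph n) (2≤r : 2 ℕ.≤ r) (part : Fin n → Fin r)
  (complete : IsCompleteMultipartite G part)
  (onto : ∀ i → ∃ λ v → part v ≡ i) where

  open EdgeWeight G (weight G) (weight-sym G)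
  open PartSizes part
  open Equivalence using (to; from)

  -- A clique meets every part at most once.
  edgeOfK⇒≤r : ∀ {u v k} → EdgeOfK G u v k → k ℕ.≤ r
  edgeOfK⇒≤r (H , iso , _) = Fin.injective⇒≤ part-injective
    where
    vtx = _≅_.from iso
    part-injective : ∀ {i j} → part (vtx i) ≡ part (vtx j) → i ≡ j
    part-injective {i} {j} p = decidable-stable (i Fin.≟ j) λ i≢j →
      to (complete (vtx i) (vtx j)) (edge⇒adj H (to (_≅_.edges iso i j) i≢j)) p

  -- One vertex from each part gives a clique; `u` and `v` represent their own parts and `onto`
  -- supplies the others.
  edgeOfK-r : ∀ {u v} → Adj G u v → EdgeOfK G u v r
  edgeOfK-r {u} {v} uv = clique⇒edgeOfK G
    (Vec.tabulate rep , clq , part u , part v , to (complete u v) uv ,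
     trans (Vec.lookup∘tabulate rep (part u)) rep-u ,
     trans (Vec.lookup∘tabulate rep (part v)) rep-v)
    where
    rep : Fin r → Fin n
    rep i with i Fin.≟ part u | i Fin.≟ part v
    ... | yes _ | _     = u
    ... | no _  | yes _ = v
    ... | no _  | no _  = proj₁ (onto i)

    part-rep : ∀ i → part (rep i) ≡ i
    part-rep i with i Fin.≟ part u | i Fin.≟ part v
    ... | yes p | _     = sym p
    ... | no _  | yes p = sym p
    ... | no _  | no _  = proj₂ (onto i)

    rep-u : rep (part u) ≡ u
    rep-u with part u Fin.≟ part u | part u Fin.≟ part v
    ... | yes _ | _ = refl
    ... | no ¬p | _ = contradiction refl ¬p

    rep-v : rep (part v) ≡ v
    rep-v with part v Fin.≟ part u | part v Fin.≟ part v
    ... | yes p | _     = contradiction (sym p) (to (complete u v) uv)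
    ... | no _  | yes _ = refl
    ... | no _  | no ¬p = contradiction refl ¬p

    clq : ∀ i j → i ≢ j → Adj G (Vec.lookup (Vec.tabulate rep) i)
                                (Vec.lookup (Vec.tabulate rep) j)
    clq i j i≢j = subst₂ (Adj G)
      (sym (Vec.lookup∘tabulate rep i)) (sym (Vec.lookup∘tabulate rep j))
      (from (complete (rep i) (rep j)) λ p →
        i≢j (trans (sym (part-rep i)) (trans p (part-rep j))))

  c≡r : ∀ {u v} (uv : Adj G u v) → c G uv ≡ r
  c≡r uv = ℕ.≤-antisym (edgeOfK⇒≤r (proj₁ (c-isLargest G uv)))
                       (proj₂ (c-isLargest G uv) (edgeOfK-r uv))

  weight-r : ∀ {u v} (uv : Adj G u v) → weight G uv * ι (r ∸ 1) ≡ ι r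
  weight-r uv = subst (λ k → weight G uv * ι (k ∸ 1) ≡ ι k) (c≡r uv)
    (/-*-cancel (c G uv) (c G uv ∸ 1) {{c∸1-nonZero G uv}})

  -- Scaled by `r − 1`, the weight is `r` across parts and zero within a part; the indicator fills
  -- in the zeros, so that every entry is constant and rows can be summed without division.
  W-part : ∀ u v → W u v * ι (r ∸ 1) + ι r * δ (part v) (part u) ≡ ι r
  W-part u v = byCases (part v Fin.≟ part u)
    where
    open ≡-Reasoning
    byCases : Dec (part v ≡ part u) →
              W u v * ι (r ∸ 1) + ι r * δ (part v) (part u) ≡ ι r
    byCases (yes p) = begin
      W u v * ι (r ∸ 1) + ι r * δ (part v) (part u)
        ≡⟨ cong₂ (λ x y → x * ι (r ∸ 1) + ι r * y)
             (W-nonadj λ uv → to (complete u v) uv (sym p)) (δ-≡ p) ⟩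
      0ℚ * ι (r ∸ 1) + ι r * 1ℚ
        ≡⟨ solve 2 (λ a b → con 0ℚ :* a :+ b :* con 1ℚ := b) refl (ι (r ∸ 1)) (ι r) ⟩
      ι r ∎
    byCases (no ¬p) = begin
      W u v * ι (r ∸ 1) + ι r * δ (part v) (part u)
        ≡⟨ cong₂ (λ x y → x * ι (r ∸ 1) + ι r * y) (W-adj uv) (δ-≢ ¬p) ⟩
      weight G uv * ι (r ∸ 1) + ι r * 0ℚ
        ≡⟨ cong₂ _+_ (weight-r uv) (*-zeroʳ (ι r)) ⟩
      ι r + 0ℚ
        ≡⟨ +-identityʳ (ι r) ⟩
      ι r ∎
      where
      uv : Adj G u v
      uv = from (complete u v) (¬p ∘ sym)

  row-part : ∀ u → sum (W u) * ι (r ∸ 1) + ι r * size (part u) ≡ ι n * ι r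
  row-part u = begin
    sum (W u) * ι (r ∸ 1) + ι r * size (part u)
      ≡⟨ cong₂ _+_ (*-distribʳ-sum (ι (r ∸ 1)) (W u))
                   (*-distribˡ-sum (ι r) (λ v → δ (part v) (part u))) ⟩
    ∑[ v < n ] (W u v * ι (r ∸ 1)) + ∑[ v < n ] (ι r * δ (part v) (part u))
      ≡⟨ ∑-distrib-+ (λ v → W u v * ι (r ∸ 1)) (λ v → ι r * δ (part v) (part u)) ⟨
    ∑[ v < n ] (W u v * ι (r ∸ 1) + ι r * δ (part v) (part u))
      ≡⟨ trans (sum-cong-≗ (W-part u)) (sum-const n (ι r)) ⟩
    ι n * ι r ∎
    where open ≡-Reasoning

  -- Sums `row-part` over all `u`: a part of size `a` contributes `a` once for each of its `a`
  -- vertices, whence `sizeSq`.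
  total-part : total * ι (r ∸ 1) + ι r * sizeSq ≡ ι n * (ι n * ι r)
  total-part = begin
    total * ι (r ∸ 1) + ι r * sizeSq
      ≡⟨ cong₂ (λ x y → x + ι r * y) (*-distribʳ-sum (ι (r ∸ 1)) (λ u → sum (W u)))
               (sym (sum-fibres size)) ⟩
    ∑[ u < n ] (sum (W u) * ι (r ∸ 1)) + ι r * ∑[ u < n ] size (part u)
      ≡⟨ cong (_+_ (∑[ u < n ] (sum (W u) * ι (r ∸ 1)))) (*-distribˡ-sum (ι r) (size ∘ part)) ⟩
    ∑[ u < n ] (sum (W u) * ι (r ∸ 1)) + ∑[ u < n ] (ι r * size (part u))
      ≡⟨ ∑-distrib-+ (λ u → sum (W u) * ι (r ∸ 1)) (λ u → ι r * size (part u)) ⟨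
    ∑[ u < n ] (sum (W u) * ι (r ∸ 1) + ι r * size (part u))
      ≡⟨ trans (sum-cong-≗ row-part) (sum-const n (ι n * ι r)) ⟩
    ι n * (ι n * ι r) ∎
    where open ≡-Reasoning

  ιr : ι r ≡ 1ℚ + ι (r ∸ 1)
  ιr = cong ι (sym (ℕ.m+[n∸m]≡n (ℕ.≤-trans (s≤s z≤n) 2≤r)))

  -- Brings the right side of `total-part` into the shape of its left side, so that both directions
  -- of the equality case become cancellations.
  n²-split : ι n * ι n * ι (r ∸ 1) + ι n * ι n ≡ ι n * (ι n * ι r)
  n²-split = trans
    (solve 2 (λ N s → N :* N :* s :+ N :* N := N :* (N :* (con 1ℚ :+ s))) refl (ι n) (ι (r ∸ 1)))
    (cong (λ x → ι n * (ι n * x)) (sym ιr))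

  total⇒sizeSq : total ≡ ι n * ι n → ι r * sizeSq ≡ ι n * ι n
  total⇒sizeSq eq = +-cancelˡ (ι n * ι n * ι (r ∸ 1)) _ _ (trans
    (subst (λ t → t * ι (r ∸ 1) + ι r * sizeSq ≡ ι n * (ι n * ι r)) eq total-part)
    (sym n²-split))

  sizeSq⇒total : ι r * sizeSq ≡ ι n * ι n → total ≡ ι n * ι n
  sizeSq⇒total eq = *-cancelʳ-≡-pos (ι (r ∸ 1)) {{ι-pos (r ∸ 1) {{r∸1≢0}}}}
    (+-cancelʳ (ι n * ι n) _ _ (trans
      (subst (λ t → total * ι (r ∸ 1) + t ≡ ι n * (ι n * ι r)) eq total-part)
      (sym n²-split)))
    where
    r∸1≢0 : ℕ.NonZero (r ∸ 1)
    r∸1≢0 = ℕ.>-nonZero (ℕ.∸-monoˡ-≤ 1 2≤r)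

  total⇒equalSizes : total ≡ ι n * ι n → ∀ i j → partSize part i ≡ partSize part j
  total⇒equalSizes eq i j = ι-injective (begin
    ι (partSize part i) ≡⟨ ι-partSize i ⟩
    size i              ≡⟨ *-cancelʳ-≡-pos (ι r) {{ι-pos r {{ℕ.>-nonZero (ℕ.≤-trans (s≤s z≤n) 2≤r)}}}} (begin
        size i * ι r    ≡⟨ *-comm (size i) (ι r) ⟩
        ι r * size i    ≡⟨ trans (n≡ i) (sym (n≡ j)) ⟩
        ι r * size j    ≡⟨ *-comm (ι r) (size j) ⟩
        size j * ι r    ∎) ⟩
    size j              ≡⟨ ι-partSize j ⟨
    ι (partSize part j) ∎)
    where
    open ≡-Reasoning
    n≡ : ∀ i → ι r * size i ≡ ι n
    n≡ = sizes-equal (total⇒sizeSq eq)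

-- Parts of equal size

module _ {n r : ℕ} (part : Fin n → Fin r)
  (equal : ∀ i j → partSize part i ≡ partSize part j) where
  open PartSizes part

  size-≡ : ∀ i j → size i ≡ size j
  size-≡ i j = trans (sym (ι-partSize i)) (trans (cong ι (equal i j)) (ι-partSize j))

  -- One empty part would make all parts empty and leave no vertices.
  equalSizes⇒onto : ℕ.NonZero n → ∀ i → ∃ λ v → part v ≡ i
  equalSizes⇒onto n≢0 i = decidable-stable (Fin.any? (λ v → part v Fin.≟ i)) λ none →
    ℕ.≢-nonZero⁻¹ n {{n≢0}} (ι-injective {n} {0} (begin
      ι n         ≡⟨ const-size (λ j → trans (size-≡ j i) (empty none)) ⟨
      ι r * 0ℚ    ≡⟨ *-zeroʳ (ι r) ⟩
      0ℚ          ∎))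
    where
    open ≡-Reasoning
    empty : ¬ (∃ λ v → part v ≡ i) → size i ≡ 0ℚ
    empty none = trans (sum-cong-≗ (λ v → δ-≢ (λ p → none (v , p))))
                       (trans (sum-const n 0ℚ) (*-zeroʳ (ι n)))

-- The inequality and its equality case for edge sums

module _ {n : ℕ} (G : Graph n) where
  open EdgeWeight G (weight G) (weight-sym G)

  total≡n²⇒equalMultipartite : ℕ.NonZero n → total ≡ ι n * ι n →
                               IsEqualCompleteMultipartite G
  total≡n²⇒equalMultipartite n≢0 eq = equalise (total≡n²⇒multipartite G {{n≢0}} eq)
    where
    equalise : (∃ λ r → 2 ℕ.≤ r × Σ[ part ∈ (Fin n → Fin r) ]
                 (IsCompleteMultipartite G part × (∀ i → ∃ λ v → part v ≡ i))) →
               IsEqualCompleteMultipartite G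
    equalise (r , 2≤r , part , complete , onto) =
      r , 2≤r , part , complete ,
      Multipartite.total⇒equalSizes G 2≤r part complete onto eq

  equalMultipartite⇒total≡n² : ℕ.NonZero n → IsEqualCompleteMultipartite G →
                               total ≡ ι n * ι n
  equalMultipartite⇒total≡n² n≢0 (r , 2≤r , part , complete , equal) =
    Multipartite.sizeSq⇒total G 2≤r part complete (equalSizes⇒onto part equal n≢0)
      -- Any fixed part can provide the common size; index 1 exists because `2≤r` says `1 < r`.
      (PartSizes.const-sizeSq part λ i → size-≡ part equal i (Fin.fromℕ< 2≤r))

  half : ℚ
  half = + (n ^ 2) / 2

  half-double : half * ι 2 ≡ ι n * ι n
  half-double = trans (/-*-cancel (n ^ 2) 2)
    (trans (cong ι (cong (n ℕ.*_) (ℕ.*-identityʳ n))) (ι-* n n))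

  edgeSum-≤ : edgeSum G (weight G) ≤ half
  edgeSum-≤ = *-cancelʳ-≤-pos (ι 2)
    (subst₂ _≤_ (sym edgeSum-total) (sym half-double) (total-≤ G))

  edgeSum≡⇔total≡ : edgeSum G (weight G) ≡ half ⇔ total ≡ ι n * ι n
  edgeSum≡⇔total≡ = mk⇔
    (λ eq → trans (sym edgeSum-total) (trans (cong (_* ι 2) eq) half-double))
    (λ eq → *-cancelʳ-≡-pos (ι 2) (trans edgeSum-total (trans eq (sym half-double))))

-- Without vertices both sides of the inequality are zero, so the multipartite structure must always
-- be available; two empty parts provide it.
order-zero : (G : Graph 0) → IsEqualCompleteMultipartite G
order-zero G = 2 , ℕ.≤-refl , (λ ()) , (λ ()) , λ _ _ → refl

theorem1 : ∀ (n : ℕ) (G : Graph n) →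
    (edgeSum G (weight G) ≤ + (n ^ 2) / 2) ×
    (edgeSum G (weight G) ≡ + (n ^ 2) / 2 ⇔ IsEqualCompleteMultipartite G)
theorem1 zero      G = edgeSum-≤ G , mk⇔ (λ _ → order-zero G) (λ _ → refl)
theorem1 n@(suc _) G = edgeSum-≤ G ,
  mk⇔ (total≡n²⇒equalMultipartite G _) (equalMultipartite⇒total≡n² G _)
    ⇔-∘ edgeSum≡⇔total≡ G
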